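{- Let $\mathcal{B}$ be a bounding family on $[n]^d$ with associated function $d_{\mathcal{B}}$, and let $\mathcal{D}=\prod_{r=1}^d\mathcal{D}_r$ be a product distribution on $[n]^d$ such that $\mu_{\mathcal{D}_r}(j)=q_r(j)/N$ for positive integer $N$ and nonnegative integers $q_r(j)$. With $\Phi$, $f_{ext}$, $d_{ext}$ as defined in the context, for every $f:[n]^d\to\mathbb{R}$, $$\mathrm{dist}_{\mathcal{D}}(f,\mathcal{P}(d_{\mathcal{B}}))=\mathrm{dist}_{\mathcal{U}}(f_{ext},\mathcal{P}(d_{ext})),$$ where $\mathcal{U}$ is the uniform distribution on $[N]^d$.
   Context: A bounding family is a tuple of $2d$ functions $l_1,u_1,\dots,l_d,u_d:[n-1]\to\mathbb{R}$ with $l_r(y)<u_r(y)$; $d_{\mathcal{B}}(x,y)=\sum_{r:x_r>y_r}\sum_{t=y_r}^{x_r-1}u_r(t)-\sum_{r:x_r<y_r}\sum_{t=x_r}^{y_r-1}l_r(t)$. For a function $\delta$ on pairs of points of a domain $X$, $\mathcal{P}(\delta)$ is the set of $g:X\to\mathbb{R}$ with $g(x)-g(y)\le\delta(x,y)$ for all $x,y\in X$ (so $\mathcal{P}(d_{\mathcal{B}})$ is the set of $f$ with $l_r(x_r)\le f(x+\mathbf{e}_r)-f(x)\le u_r(x_r)$). For $t\in[N]$, $\phi_r(t)$ is the unique $\ell\in[n]$ with $\sum_{j<\ell}q_r(j)<t\le\sum_{j\le\ell}q_r(j)$, and $\Phi:[N]^d\to[n]^d$, $\Phi(x)=(\phi_1(x_1),\dots,\phi_d(x_d))$.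 Define $f_{ext}(x)=f(\Phi(x))$ and $d_{ext}(x,y)=d_{\mathcal{B}}(\Phi(x),\Phi(y))$ for $x,y\in[N]^d$. $\mathrm{dist}_{\mathcal{D}}(f,\mathcal{P})=\inf_{g\in\mathcal{P}}\Pr_{x\sim\mathcal{D}}[f(x)\ne g(x)]$. -}

module Defs where

open import Algebra.Bundles using (CommutativeRing)
import Algebra.Properties.CommutativeMonoid.Sum as MonoidSum
import Algebra.Properties.Monoid.Sum
import Algebra.Properties.Ring
import Algebra.Properties.Semiring.Mult
import Algebra.Properties.Semiring.Sum
open import Data.Bool.Base using (if_then_else_)
open import Data.Fin.Base using (Fin; zero; suc; toℕ)
open import Data.Fin.Properties using (toℕ<n; toℕ-injective)
open import Data.Nat as ℕ using (ℕ; zero; suc; NonZero)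
import Data.Nat.Properties as ℕₚ
open import Data.Product using (∃; ∃-syntax; ∃!; _×_; _,_; proj₁; proj₂)
open import Data.Sum.Base using (inj₁; inj₂)
open import Data.Vec.Base using (Vec; []; _∷_; lookup; tabulate)
open import Function.Base using (_∘_)
open import Level using (0ℓ)
open import Relation.Binary.Core using (Rel)
open import Relation.Binary.PropositionalEquality.Core as ≡ using (_≡_)
open import Relation.Binary.Structures using (IsDecTotalOrder)
import Relation.Binary.Construct.NonStrictToStrict as ToStrict
import Relation.Binary.Reasoning.Setoid as SetoidReasoning
open import Relation.Nullary.Decidable using (does; ¬?; _×-dec_; yes; no)
open import Relation.Nullary.Negation using (contradiction)
open import Relation.Unary using (Pred; Decidable; _∈_)

-- The real numbers, axiomatised as a Dedekind-complete ordered field, which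
-- determines them up to isomorphism.  The order is decidable because ℝ is
-- meant classically (real functions are compared for equality pointwise).
-- The value of _⁻¹ at zero is unconstrained.

record Reals : Set₁ where
  infix  4 _≤_
  infix  8 _⁻¹
  infixl 7 _/_
  field
    commutativeRing : CommutativeRing 0ℓ 0ℓ
  open CommutativeRing commutativeRing public hiding (zero)
  field
    _≤_             : Rel Carrier 0ℓ
    isDecTotalOrder : IsDecTotalOrder _≈_ _≤_
    +-monoˡ-≤       : ∀ {x y} z → x ≤ y → x + z ≤ y + z
    *-nonneg        : ∀ {x y} → 0# ≤ x → 0# ≤ y → 0# ≤ x * y
    1≉0             : 1# ≉ 0#
    _⁻¹             : Carrier → Carrier
    *-inverseʳ      : ∀ {x} → x ≉ 0# → x * x ⁻¹ ≈ 1#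

  module Order = IsDecTotalOrder isDecTotalOrder
  open Order public using (_≟_; _≤?_)
  open ToStrict _≈_ _≤_ public using (_<_)

  UpperBound : Pred Carrier 0ℓ → Pred Carrier 0ℓ
  UpperBound S b = ∀ x → x ∈ S → x ≤ b

  LowerBound : Pred Carrier 0ℓ → Pred Carrier 0ℓ
  LowerBound S b = ∀ x → x ∈ S → b ≤ x

  IsSupremum : Pred Carrier 0ℓ → Pred Carrier 0ℓ
  IsSupremum S s = UpperBound S s × (∀ b → UpperBound S b → s ≤ b)

  IsInfimum : Pred Carrier 0ℓ → Pred Carrier 0ℓ
  IsInfimum S s = LowerBound S s × (∀ b → LowerBound S b → b ≤ s)

  field
    complete : ∀ (S : Pred Carrier 0ℓ) → ∃ S → ∃ (UpperBound S) → ∃ (IsSupremum S)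

  _/_ : Carrier → Carrier → Carrier
  x / y = x * y ⁻¹

  open Algebra.Properties.Semiring.Mult semiring using () renaming (_×_ to _·_)

  fromℕ : ℕ → Carrier
  fromℕ k = k · 1#

open Algebra.Properties.Monoid.Sum ℕₚ.+-0-monoid using () renaming (sum to sumℕ)

-- [n] is represented by Fin n, the element i standing for toℕ i + 1.

Point : ℕ → ℕ → Set
Point n d = Vec (Fin n) d

-- Sum of the first k values of q.
cumul : ∀ {n} → (Fin n → ℕ) → ℕ → ℕ
cumul q k = sumℕ λ j → if does (toℕ j ℕ.<? k) then q j else 0

-- ∑_{j<ℓ} q(j) < t ≤ ∑_{j≤ℓ} q(j), where t ∈ [N] is suc (toℕ t) as a number.
InBlock : ∀ {n N} → (Fin n → ℕ) → Fin N → Fin n → Set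
InBlock q t ℓ = cumul q (toℕ ℓ) ℕ.< suc (toℕ t) × suc (toℕ t) ℕ.≤ cumul q (suc (toℕ ℓ))

private
  cumul-zero : ∀ {n} (q : Fin n → ℕ) → cumul q 0 ≡ 0
  cumul-zero {zero}  q = ≡.refl
  cumul-zero {suc n} q = cumul-zero (q ∘ suc)

  cumul-mono : ∀ {n} (q : Fin n → ℕ) {k m} → k ℕ.≤ m → cumul q k ℕ.≤ cumul q m
  cumul-mono {zero}  q k≤m = ℕ.z≤n
  cumul-mono {suc n} q {zero}  {m} _ = ℕₚ.≤-trans (ℕₚ.≤-reflexive (cumul-zero q)) ℕ.z≤n
  cumul-mono {suc n} q {suc k} {suc m} (ℕ.s≤s k≤m) = ℕₚ.+-monoʳ-≤ (q zero) (cumul-mono (q ∘ suc) k≤m)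

  block-exists : ∀ {n} (q : Fin n → ℕ) t → t ℕ.< sumℕ q →
                 ∃ λ (ℓ : Fin n) → cumul q (toℕ ℓ) ℕ.≤ t × t ℕ.< cumul q (suc (toℕ ℓ))
  block-exists {zero}  q t ()
  block-exists {suc n} q t t<Σ with t ℕ.<? q zero
  ... | yes t<q = zero , ℕₚ.≤-trans (ℕₚ.≤-reflexive (cumul-zero q)) ℕ.z≤n
                , ℕₚ.<-≤-trans t<q (ℕₚ.m≤m+n _ _)
  ... | no  t≮q with ℕₚ.m≤n⇒∃[o]m+o≡n (ℕₚ.≮⇒≥ t≮q)
  ...   | s , ≡.refl with block-exists (q ∘ suc) s (ℕₚ.+-cancelˡ-< (q zero) _ _ t<Σ)
  ...     | ℓ , lo , hi = suc ℓ , ℕₚ.+-monoʳ-≤ (q zero) lo , ℕₚ.+-monoʳ-< (q zero) hi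

block : ∀ {n N} (q : Fin n → ℕ) → sumℕ q ≡ N → (t : Fin N) → ∃! _≡_ (InBlock q t)
block q ≡.refl t with block-exists q (toℕ t) (toℕ<n t)
... | ℓ , lo , hi = ℓ , (ℕ.s≤s lo , hi) , λ {ℓ′} (lo′ , hi′) → toℕ-injective
    (ℕₚ.≤-antisym
      (ℕₚ.≮⇒≥ λ ℓ′<ℓ → ℕₚ.<-irrefl ≡.refl
        (ℕₚ.<-≤-trans hi′ (ℕₚ.≤-trans (cumul-mono q ℓ′<ℓ) lo)))
      (ℕₚ.≮⇒≥ λ ℓ<ℓ′ → ℕₚ.<-irrefl ≡.refl
        (ℕₚ.<-≤-trans hi (ℕₚ.≤-trans (cumul-mono q ℓ<ℓ′) (ℕ.s≤s⁻¹ lo′)))))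

φ : ∀ {n N} (q : Fin n → ℕ) → sumℕ q ≡ N → Fin N → Fin n
φ q Σq≡N t = proj₁ (block q Σq≡N t)

Φ : ∀ {n N d} (q : Fin d → Fin n → ℕ) → (∀ r → sumℕ (q r) ≡ N) → Point N d → Point n d
Φ q Σq≡N x = tabulate λ r → φ (q r) (Σq≡N r) (lookup x r)

module RealFunctions (R : Reals) where
  open Reals R renaming (Carrier to ℝ) public

  open Algebra.Properties.Semiring.Sum semiring
    using (sum; sum-cong-≋; *-distribʳ-sum)
  open MonoidSum *-commutativeMonoid using () renaming (sum to product)

  -- Fin (n ∸ 1) represents [n - 1].
  record BoundingFamily (n d : ℕ) : Set where
    field
      l u : Fin d → Fin (n ℕ.∸ 1) → ℝ
      l<u : ∀ r y → l r y < u r y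

  -- ∑ of h(t) over a ≤ t ≤ b - 1.
  sumBetween : ∀ {m} → ℕ → ℕ → (Fin m → ℝ) → ℝ
  sumBetween a b h = sum λ t → if does ((a ℕ.≤? toℕ t) ×-dec (toℕ t ℕ.<? b)) then h t else 0#

  dist-𝓑 : ∀ {n d} → BoundingFamily n d → Point n d → Point n d → ℝ
  dist-𝓑 𝓑 x y =
      sum (λ r → if does (y′ r ℕ.<? x′ r) then sumBetween (y′ r) (x′ r) (u r) else 0#)
    - sum (λ r → if does (x′ r ℕ.<? y′ r) then sumBetween (x′ r) (y′ r) (l r) else 0#)
    where
      open BoundingFamily 𝓑
      x′ = λ r → toℕ (lookup x r)
      y′ = λ r → toℕ (lookup y r)

  𝓟 : {X : Set} → (X → X → ℝ) → Pred (X → ℝ) 0ℓ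
  𝓟 δ g = ∀ x y → g x - g y ≤ δ x y

  -- Distributions are given by their probability mass functions.
  IsDistribution : ∀ {n} → (Fin n → ℝ) → Set
  IsDistribution μ = (∀ j → 0# ≤ μ j) × sum μ ≈ 1#

  productMass : ∀ {n d} → (Fin d → Fin n → ℝ) → Point n d → ℝ
  productMass μ x = product λ r → μ r (lookup x r)

  uniform : ∀ {n d} → Point n d → ℝ
  uniform {n} {d} _ = 1# / fromℕ (n ℕ.^ d)

  sumPoints : ∀ {n} d → (Point n d → ℝ) → ℝ
  sumPoints zero    F = F []
  sumPoints (suc d) F = sum λ i → sumPoints d (F ∘ (i ∷_))

  Pr : ∀ {n d} → (Point n d → ℝ) → {A : Pred (Point n d) 0ℓ} → Decidable A → ℝ
  Pr {d = d} μ A? = sumPoints d λ x → if does (A? x) then μ x else 0#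

  -- v = dist_μ(f, P).  The infimum is a relation: it need not exist if P is empty.
  IsDist : ∀ {n d} → (Point n d → ℝ) → (Point n d → ℝ) → Pred (Point n d → ℝ) 0ℓ → ℝ → Set
  IsDist μ f P = IsInfimum λ p → ∃[ g ] g ∈ P × p ≈ Pr μ (λ x → ¬? (f x ≟ g x))

  private
    module ≤ = IsDecTotalOrder isDecTotalOrder
    open Algebra.Properties.Ring ring using (-‿distribˡ-*; -‿involutive; +-cancelˡ)
    open Algebra.Properties.Semiring.Mult semiring using (×-homo-+)
    open SetoidReasoning setoid

    0≤1 : 0# ≤ 1#
    0≤1 with ≤.total 0# 1#
    ... | inj₁ 0≤1 = 0≤1
    ... | inj₂ 1≤0 = ≤.trans (*-nonneg 0≤-1 0≤-1) (≤.reflexive eq)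
      where
      0≤-1 : 0# ≤ - 1#
      0≤-1 = ≤.trans (≤.reflexive (sym (-‿inverseʳ 1#)))
                     (≤.trans (+-monoˡ-≤ (- 1#) 1≤0) (≤.reflexive (+-identityˡ _)))
      eq : (- 1#) * (- 1#) ≈ 1#
      eq = begin
        (- 1#) * (- 1#) ≈⟨ -‿distribˡ-* 1# (- 1#) ⟨
        - (1# * - 1#)   ≈⟨ -‿cong (*-identityˡ _) ⟩
        - (- 1#)        ≈⟨ -‿involutive 1# ⟩
        1#              ∎

    1≤fromℕ-suc : ∀ k → 1# ≤ fromℕ (suc k)
    1≤fromℕ-suc zero    = ≤.reflexive (sym (+-identityʳ 1#))
    1≤fromℕ-suc (suc k) = ≤.trans (1≤fromℕ-suc k)
      (≤.trans (≤.reflexive (sym (+-identityˡ _))) (+-monoˡ-≤ _ 0≤1))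

    fromℕ-suc≉0 : ∀ k → fromℕ (suc k) ≉ 0#
    fromℕ-suc≉0 k eq = 1≉0 (≤.antisym (≤.trans (1≤fromℕ-suc k) (≤.reflexive eq)) 0≤1)

    fromℕ-injective : ∀ j k → fromℕ j ≈ fromℕ k → j ≡ k
    fromℕ-injective zero    zero    eq = ≡.refl
    fromℕ-injective zero    (suc k) eq = contradiction (sym eq) (fromℕ-suc≉0 k)
    fromℕ-injective (suc j) zero    eq = contradiction eq (fromℕ-suc≉0 j)
    fromℕ-injective (suc j) (suc k) eq = ≡.cong suc (fromℕ-injective j k (+-cancelˡ _ _ _ eq))

    fromℕ-sum : ∀ {n} (q : Fin n → ℕ) → sum (fromℕ ∘ q) ≈ fromℕ (sumℕ q)
    fromℕ-sum {zero}  q = refl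
    fromℕ-sum {suc n} q = trans (+-congˡ (fromℕ-sum (q ∘ suc))) (sym (×-homo-+ 1# (q zero) _))

  -- ∑_j q(j) = N, so that φ is defined on all of [N].
  sum-weights : ∀ {n} N .{{_ : NonZero N}} {μ : Fin n → ℝ} {q : Fin n → ℕ} →
                IsDistribution μ → (∀ j → μ j ≈ fromℕ (q j) / fromℕ N) → sumℕ q ≡ N
  sum-weights N@(suc N-1) {μ} {q} (_ , Σμ≈1) μ≈ = fromℕ-injective _ _ (begin
    fromℕ (sumℕ q)                              ≈⟨ fromℕ-sum q ⟨
    sum (fromℕ ∘ q)                             ≈⟨ *-identityʳ _ ⟨
    sum (fromℕ ∘ q) * 1#                        ≈⟨ *-congˡ (*-inverseʳ (fromℕ-suc≉0 N-1)) ⟨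
    sum (fromℕ ∘ q) * (fromℕ N * fromℕ N ⁻¹)    ≈⟨ *-congˡ (*-comm _ _) ⟩
    sum (fromℕ ∘ q) * (fromℕ N ⁻¹ * fromℕ N)    ≈⟨ *-assoc _ _ _ ⟨
    sum (fromℕ ∘ q) * fromℕ N ⁻¹ * fromℕ N      ≈⟨ *-congʳ (*-distribʳ-sum _ (fromℕ ∘ q)) ⟩
    sum (λ j → fromℕ (q j) / fromℕ N) * fromℕ N ≈⟨ *-congʳ (sum-cong-≋ μ≈) ⟨
    sum μ * fromℕ N                             ≈⟨ *-congʳ Σμ≈1 ⟩
    1# * fromℕ N                                ≈⟨ *-identityˡ _ ⟩
    fromℕ N                                     ∎)

{-# OPTIONS --safe #-}

-- Every h in 𝓟(d_ext) has the form g ∘ Φ with g in 𝓟(d_𝓑): since d_𝓑 satisfies the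
-- triangle inequality, the McShane extension g x = min_y (h y + d_𝓑(x, Φ y)) works.
-- Conversely g ∘ Φ lies in 𝓟(d_ext) for every g in 𝓟(d_𝓑).  As Φ pushes the uniform
-- distribution forward to 𝓓, both infima are taken over the same set of probabilities.

module Submission where

import Algebra.Properties.AbelianGroup
import Algebra.Properties.CommutativeMonoid.Sum
import Algebra.Properties.CommutativeSemigroup
import Algebra.Properties.Monoid.Sum
import Algebra.Properties.Ring
import Algebra.Properties.Semiring.Mult
import Algebra.Properties.Semiring.Sum
open import Data.Bool.Base using (Bool; true; false; not; _∧_; if_then_else_)
open import Data.Fin.Base using (Fin; zero; suc; toℕ; _↑ˡ_; _↑ʳ_)
open import Data.Fin.Properties using (toℕ<n; toℕ-↑ˡ; toℕ-↑ʳ)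
open import Data.List.Base using (allFin)
import Data.List.Extrema
open import Data.List.Membership.Propositional.Properties using (∈-allFin)
import Data.List.Relation.Unary.All as All
open import Data.Nat as ℕ using (ℕ; zero; suc; NonZero)
import Data.Nat.Properties as ℕₚ
open import Data.Product.Base using (_×_; _,_; proj₁; proj₂; ∃; ∃-syntax)
open import Data.Sum.Base using (inj₁; inj₂)
open import Data.Vec.Base using ([]; _∷_; lookup; replicate)
open import Function.Base using (_∘_; _on_)
open import Function.Bundles using (mk⇔)
open import Level using (0ℓ)
open import Relation.Binary.Bundles using (DecTotalOrder)
open import Relation.Binary.PropositionalEquality as ≡ using (_≡_)
import Relation.Binary.Reasoning.PartialOrder
open import Relation.Nullary.Decidable using (Dec; yes; no; does; ¬?; does-⇔; dec-false; _×-dec_)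
open import Relation.Nullary.Negation using (¬_)
open import Relation.Unary using (Pred; Decidable; _∈_; _⊆_)
open import Defs

open Algebra.Properties.Monoid.Sum ℕₚ.+-0-monoid using () renaming (sum to sumℕ)

-- Blocks of `φ` under splitting off the first weight.

cumul-zero : ∀ {n} (q : Fin n → ℕ) → cumul q 0 ≡ 0
cumul-zero {zero}  q = ≡.refl
cumul-zero {suc n} q = cumul-zero (q ∘ suc)

φ-inBlock : ∀ {n N} (q : Fin n → ℕ) (Σq≡N : sumℕ q ≡ N) t → InBlock q t (φ q Σq≡N t)
φ-inBlock q Σq≡N t = proj₁ (proj₂ (block q Σq≡N t))

φ-unique : ∀ {n N} (q : Fin n → ℕ) (Σq≡N : sumℕ q ≡ N) t {ℓ} → InBlock q t ℓ → φ q Σq≡N t ≡ ℓ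
φ-unique q Σq≡N t = proj₂ (proj₂ (block q Σq≡N t))

-- With `[N]` cut into its first `q zero` elements and the rest, the first piece is exactly the
-- block of `zero`. Together with `φ-↑ʳ` this gives the recursion behind `sum-φ`.
φ-↑ˡ : ∀ {n} (q : Fin (suc n) → ℕ) (t : Fin (q zero)) →
       φ q ≡.refl (t ↑ˡ sumℕ (q ∘ suc)) ≡ zero
φ-↑ˡ q t = φ-unique q ≡.refl _
  ( ℕ.s≤s (ℕₚ.≤-trans (ℕₚ.≤-reflexive (cumul-zero q)) ℕ.z≤n)
  , ℕₚ.≤-trans (ℕₚ.≤-reflexive (≡.cong suc (toℕ-↑ˡ t _)))
      (ℕₚ.≤-trans (toℕ<n t) (ℕₚ.m≤m+n _ _)) )

-- Both block inequalities for the tail weights are translated by `q zero`, and uniqueness of the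
-- block then identifies the value of `φ`.
φ-↑ʳ : ∀ {n} (q : Fin (suc n) → ℕ) (t : Fin (sumℕ (q ∘ suc))) →
       φ q ≡.refl (q zero ↑ʳ t) ≡ suc (φ (q ∘ suc) ≡.refl t)
φ-↑ʳ q t = φ-unique q ≡.refl _ (shift (φ-inBlock (q ∘ suc) ≡.refl t))
  where
  shift : ∀ {ℓ} → InBlock (q ∘ suc) t ℓ → InBlock q (q zero ↑ʳ t) (suc ℓ)
  shift (lo , hi) rewrite toℕ-↑ʳ (q zero) t =
    ℕ.s≤s (ℕₚ.+-monoʳ-≤ (q zero) (ℕ.s≤s⁻¹ lo)) , ℕₚ.+-monoʳ-< (q zero) hi

does-≤?-not : ∀ m n → does (m ℕ.≤? n) ≡ not (does (n ℕ.<? m))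
does-≤?-not m n = does-⇔ (mk⇔ ℕₚ.≤⇒≯ ℕₚ.≮⇒≥) (m ℕ.≤? n) (¬? (n ℕ.<? m))

module RealLemmas (R : Reals) where
  open RealFunctions R
  open Algebra.Properties.AbelianGroup +-abelianGroup
    using (//-rightDividesˡ) renaming (⁻¹-∙-comm to -‿+-comm)
  open Algebra.Properties.CommutativeMonoid.Sum +-commutativeMonoid using (∑-distrib-+)
  open Algebra.Properties.CommutativeMonoid.Sum *-commutativeMonoid using () renaming (sum to product)
  open Algebra.Properties.CommutativeSemigroup +-commutativeSemigroup
    using () renaming (x∙yz≈y∙xz to +-leftSwap)
  open Algebra.Properties.CommutativeSemigroup *-commutativeSemigroup
    using () renaming (x∙yz≈y∙xz to *-leftSwap)
  open Algebra.Properties.Ring ring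
    using (-‿distribˡ-*; -‿involutive; -0#≈0#)
  open Algebra.Properties.Semiring.Mult semiring using (×1-homo-*; ×-assoc-*; ×-congʳ)
  open Algebra.Properties.Semiring.Sum semiring
    using (sum; sum-cong-≋; sum-replicate; sum-replicate-zero; *-distribˡ-sum)

  decTotalOrder : DecTotalOrder 0ℓ 0ℓ 0ℓ
  decTotalOrder = record { isDecTotalOrder = isDecTotalOrder }

  open DecTotalOrder decTotalOrder using (poset; totalOrder)
  open Data.List.Extrema totalOrder using (argmin; f[argmin]≤f[xs])
  open Relation.Binary.Reasoning.PartialOrder poset

  -- Arithmetic of the ordered field.

  +-monoʳ-≤ : ∀ x {y z} → y ≤ z → x + y ≤ x + z
  +-monoʳ-≤ x {y} {z} y≤z = begin
    x + y ≈⟨ +-comm x y ⟩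
    y + x ≤⟨ +-monoˡ-≤ x y≤z ⟩
    z + x ≈⟨ +-comm z x ⟩
    x + z ∎

  +-mono-≤ : ∀ {w x y z} → w ≤ x → y ≤ z → w + y ≤ x + z
  +-mono-≤ w≤x y≤z = Order.trans (+-monoˡ-≤ _ w≤x) (+-monoʳ-≤ _ y≤z)

  x≤y+z⇒x-z≤y : ∀ {x y z} → x ≤ y + z → x - z ≤ y
  x≤y+z⇒x-z≤y {x} {y} {z} x≤y+z = begin
    x - z         ≤⟨ +-monoˡ-≤ (- z) x≤y+z ⟩
    y + z - z     ≈⟨ +-assoc y z (- z) ⟩
    y + (z - z)   ≈⟨ +-congˡ (-‿inverseʳ z) ⟩
    y + 0#        ≈⟨ +-identityʳ y ⟩
    y             ∎

  x-z≤y⇒x≤y+z : ∀ {x y z} → x - z ≤ y → x ≤ y + z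
  x-z≤y⇒x≤y+z {x} {y} {z} x-z≤y = begin
    x         ≈⟨ //-rightDividesˡ z x ⟨
    x - z + z ≤⟨ +-monoˡ-≤ z x-z≤y ⟩
    y + z     ∎

  -- By totality, the alternative `1# ≤ 0#` makes `- 1#` nonnegative, and hence its square, which is
  -- `1#`.
  0≤1 : 0# ≤ 1#
  0≤1 with Order.total 0# 1#
  ... | inj₁ 0≤1 = 0≤1
  ... | inj₂ 1≤0 = begin
    0#              ≤⟨ *-nonneg 0≤-1 0≤-1 ⟩
    (- 1#) * (- 1#) ≈⟨ -‿distribˡ-* 1# (- 1#) ⟨
    - (1# * - 1#)   ≈⟨ -‿cong (*-identityˡ _) ⟩
    - (- 1#)        ≈⟨ -‿involutive 1# ⟩
    1#              ∎
    where
    0≤-1 : 0# ≤ - 1#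
    0≤-1 = begin
      0#      ≈⟨ -‿inverseʳ 1# ⟨
      1# - 1# ≤⟨ +-monoˡ-≤ (- 1#) 1≤0 ⟩
      0# - 1# ≈⟨ +-identityˡ _ ⟩
      - 1#    ∎

  0≤fromℕ : ∀ k → 0# ≤ fromℕ k
  0≤fromℕ zero    = Order.refl
  0≤fromℕ (suc k) = begin
    0#           ≈⟨ +-identityʳ 0# ⟨
    0# + 0#      ≤⟨ +-mono-≤ 0≤1 (0≤fromℕ k) ⟩
    1# + fromℕ k ∎

  fromℕ≉0 : ∀ k .{{_ : NonZero k}} → fromℕ k ≉ 0#
  fromℕ≉0 (suc k) eq = 1≉0 (Order.antisym 1≤0 0≤1)
    where
    1≤0 : 1# ≤ 0#
    1≤0 = begin
      1#           ≈⟨ +-identityʳ 1# ⟨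
      1# + 0#      ≤⟨ +-monoʳ-≤ 1# (0≤fromℕ k) ⟩
      1# + fromℕ k ≈⟨ eq ⟩
      0#           ∎

  -- Finite sums and products.

  if-*-indicator : ∀ b x → (if b then x else 0#) ≈ x * (if b then 1# else 0#)
  if-*-indicator true  x = sym (*-identityʳ x)
  if-*-indicator false x = sym (zeroʳ x)

  sum-mono-≤ : ∀ {n} {f g : Fin n → ℝ} → (∀ i → f i ≤ g i) → sum f ≤ sum g
  sum-mono-≤ {zero}  f≤g = Order.refl
  sum-mono-≤ {suc n} f≤g = +-mono-≤ (f≤g zero) (sum-mono-≤ (f≤g ∘ suc))

  sum-zero : ∀ {n} {f : Fin n → ℝ} → (∀ i → f i ≈ 0#) → sum f ≈ 0#
  sum-zero {n} f≈0 = trans (sum-cong-≋ {n} f≈0) (sum-replicate-zero n)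

  sum-nonneg : ∀ {n} {f : Fin n → ℝ} → (∀ i → 0# ≤ f i) → 0# ≤ sum f
  sum-nonneg {n} 0≤f = Order.trans (Order.reflexive (sym (sum-replicate-zero n))) (sum-mono-≤ 0≤f)

  sum-neg : ∀ {n} (f : Fin n → ℝ) → sum (λ i → - f i) ≈ - sum f
  sum-neg {zero}  f = sym -0#≈0#
  sum-neg {suc n} f = trans (+-congˡ (sum-neg (f ∘ suc))) (-‿+-comm _ _)

  sum-distrib-- : ∀ {n} (f g : Fin n → ℝ) → sum (λ i → f i - g i) ≈ sum f - sum g
  sum-distrib-- f g = trans (∑-distrib-+ f (λ i → - g i)) (+-congˡ (sum-neg g))

  sum-split : ∀ m {n} (f : Fin (m ℕ.+ n) → ℝ) →
              sum f ≈ sum (f ∘ (_↑ˡ n)) + sum (f ∘ (m ↑ʳ_))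
  sum-split zero    f = sym (+-identityˡ _)
  sum-split (suc m) f = trans (+-congˡ (sum-split m (f ∘ suc))) (sym (+-assoc _ _ _))

  sum-constant : ∀ n x → sum {n} (λ _ → x) ≈ fromℕ n * x
  sum-constant n x = begin-equality
    sum {n} (λ _ → x) ≈⟨ sum-replicate n ⟩
    _                 ≈⟨ ×-congʳ n (*-identityˡ x) ⟨
    _                 ≈⟨ ×-assoc-* n 1# x ⟨
    fromℕ n * x       ∎

  product-nonneg : ∀ {n} {f : Fin n → ℝ} → (∀ i → 0# ≤ f i) → 0# ≤ product f
  product-nonneg {zero}  0≤f = 0≤1
  product-nonneg {suc n} 0≤f = *-nonneg (0≤f zero) (product-nonneg (0≤f ∘ suc))

  -- Sums over the grid and probabilities.

  sumPoints-cong : ∀ {n} d {F G : Point n d → ℝ} → (∀ x → F x ≈ G x) → sumPoints d F ≈ sumPoints d G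
  sumPoints-cong zero    F≈G = F≈G []
  sumPoints-cong (suc d) F≈G = sum-cong-≋ λ i → sumPoints-cong d (F≈G ∘ (i ∷_))

  sumPoints-nonneg : ∀ {n} d {F : Point n d → ℝ} → (∀ x → 0# ≤ F x) → 0# ≤ sumPoints d F
  sumPoints-nonneg zero    0≤F = 0≤F []
  sumPoints-nonneg (suc d) 0≤F = sum-nonneg λ i → sumPoints-nonneg d (0≤F ∘ (i ∷_))

  *-distribˡ-sumPoints : ∀ {n} d x (F : Point n d → ℝ) → x * sumPoints d F ≈ sumPoints d (λ p → x * F p)
  *-distribˡ-sumPoints zero    x F = refl
  *-distribˡ-sumPoints {n} (suc d) x F = trans (*-distribˡ-sum {n} x _)
    (sum-cong-≋ {n} λ i → *-distribˡ-sumPoints d x (F ∘ (i ∷_)))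

  Pr-cong : ∀ {n d} (μ : Point n d → ℝ) {A B : Pred (Point n d) 0ℓ} (A? : Decidable A) (B? : Decidable B) →
            A ⊆ B → B ⊆ A → Pr μ A? ≈ Pr μ B?
  Pr-cong μ A? B? A⊆B B⊆A = sumPoints-cong _ λ x →
    reflexive (≡.cong (if_then μ x else 0#) (does-⇔ (mk⇔ A⊆B B⊆A) (A? x) (B? x)))

  Pr-nonneg : ∀ {n d} {μ : Point n d → ℝ} {A : Pred (Point n d) 0ℓ} (A? : Decidable A) →
              (∀ x → 0# ≤ μ x) → 0# ≤ Pr μ A?
  Pr-nonneg {d = d} {μ} A? 0≤μ = sumPoints-nonneg d λ x → if-nonneg (does (A? x)) (0≤μ x)
    where
    if-nonneg : ∀ b {y} → 0# ≤ y → 0# ≤ (if b then y else 0#)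
    if-nonneg true  0≤y = 0≤y
    if-nonneg false _   = Order.refl

  -- Push-forward of the uniform distribution along `Φ`.

  -- The fibre of `φ` over `j` has `q j` elements. Induction on `n` peels off the first block, on
  -- which the summand is constant.
  sum-φ : ∀ {n N} (q : Fin n → ℕ) (Σq≡N : sumℕ q ≡ N) (F : Fin n → ℝ) →
          sum (F ∘ φ q Σq≡N) ≈ sum (λ j → fromℕ (q j) * F j)
  sum-φ {zero}  q ≡.refl F = refl
  sum-φ {suc n} q ≡.refl F = begin-equality
    sum (F ∘ φ q ≡.refl)
      ≈⟨ sum-split (q zero) {M} (F ∘ φ q ≡.refl) ⟩
    sum (λ t → F (φ q ≡.refl (t ↑ˡ M))) + sum (λ t → F (φ q ≡.refl (q zero ↑ʳ t)))
      ≈⟨ +-cong (sum-cong-≋ {q zero} λ t → reflexive (≡.cong F (φ-↑ˡ q t)))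
                (sum-cong-≋ {M} λ t → reflexive (≡.cong F (φ-↑ʳ q t))) ⟩
    sum {q zero} (λ _ → F zero) + sum (F ∘ suc ∘ φ (q ∘ suc) ≡.refl)
      ≈⟨ +-cong (sum-constant (q zero) (F zero)) (sum-φ (q ∘ suc) ≡.refl (F ∘ suc)) ⟩
    fromℕ (q zero) * F zero + sum (λ j → fromℕ (q (suc j)) * F (suc j)) ∎
    where
    M : ℕ
    M = sumℕ (q ∘ suc)

  -- Induction on `d`, one coordinate at a time by `sum-φ`. The constant `c` is any inverse of
  -- `N ^ d` rather than a fixed quotient, because the induction hypothesis is applied to
  -- `fromℕ N * c` in one dimension fewer.
  sumPoints-Φ : ∀ {n N} d {μ : Fin d → Fin n → ℝ} (q : Fin d → Fin n → ℕ) (Σq≡N : ∀ r → sumℕ (q r) ≡ N) →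
                (∀ r j → μ r j * fromℕ N ≈ fromℕ (q r j)) →
                ∀ (G : Point n d → ℝ) {c} → fromℕ (N ℕ.^ d) * c ≈ 1# →
                sumPoints d (λ x → c * G (Φ q Σq≡N x)) ≈ sumPoints d (λ x → productMass μ x * G x)
  -- For `d` equal to 0 the hypothesis says `(1# + 0#) * c ≈ 1#`, so `c` equals the empty product of
  -- masses.
  sumPoints-Φ zero q Σq≡N μN≈q G {c} 1c≈1 = *-congʳ (begin-equality
    c                ≈⟨ *-identityˡ c ⟨
    1# * c           ≈⟨ *-congʳ (+-identityʳ 1#) ⟨
    (1# + 0#) * c    ≈⟨ 1c≈1 ⟩
    1#               ∎)
  sumPoints-Φ {n} {N} (suc d) {μ} q Σq≡N μN≈q G {c} Nᵈ⁺¹c≈1 = begin-equality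
    sum (S ∘ φ (q zero) (Σq≡N zero))
      ≈⟨ sum-φ (q zero) (Σq≡N zero) S ⟩
    sum (λ i → fromℕ (q zero i) * S i)
      ≈⟨ sum-cong-≋ fibre ⟩
    sum (λ i → sumPoints d λ x → productMass μ (i ∷ x) * G (i ∷ x)) ∎
    where
    Φ′ : Point N d → Point n d
    Φ′ = Φ (q ∘ suc) (Σq≡N ∘ suc)

    S : Fin n → ℝ
    S i = sumPoints d λ x → c * G (i ∷ Φ′ x)

    Nᵈ[Nc]≈1 : fromℕ (N ℕ.^ d) * (fromℕ N * c) ≈ 1#
    Nᵈ[Nc]≈1 = begin-equality
      fromℕ (N ℕ.^ d) * (fromℕ N * c) ≈⟨ *-leftSwap _ _ _ ⟩
      fromℕ N * (fromℕ (N ℕ.^ d) * c) ≈⟨ *-assoc _ _ _ ⟨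
      fromℕ N * fromℕ (N ℕ.^ d) * c   ≈⟨ *-congʳ (×1-homo-* N (N ℕ.^ d)) ⟨
      fromℕ (N ℕ.^ suc d) * c         ≈⟨ Nᵈ⁺¹c≈1 ⟩
      1#                              ∎

    fibre : ∀ i → fromℕ (q zero i) * S i ≈ sumPoints d λ x → productMass μ (i ∷ x) * G (i ∷ x)
    fibre i = begin-equality
      fromℕ (q zero i) * S i
        -- The fibre size is traded for mass times `N`. The mass stays outside as the first factor
        -- of the product mass, and the factor `N` moves into the constant.
        ≈⟨ *-congʳ (μN≈q zero i) ⟨
      μ zero i * fromℕ N * S i
        ≈⟨ *-assoc _ _ _ ⟩
      μ zero i * (fromℕ N * S i)
        ≈⟨ *-congˡ (*-distribˡ-sumPoints d (fromℕ N) _) ⟩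
      μ zero i * sumPoints d (λ x → fromℕ N * (c * G (i ∷ Φ′ x)))
        ≈⟨ *-congˡ (sumPoints-cong d λ x → *-assoc _ _ _) ⟨
      μ zero i * sumPoints d (λ x → fromℕ N * c * G (i ∷ Φ′ x))
        ≈⟨ *-congˡ (sumPoints-Φ d (q ∘ suc) (Σq≡N ∘ suc) (μN≈q ∘ suc) (G ∘ (i ∷_)) Nᵈ[Nc]≈1) ⟩
      μ zero i * sumPoints d (λ x → productMass (μ ∘ suc) x * G (i ∷ x))
        ≈⟨ *-distribˡ-sumPoints d (μ zero i) _ ⟩
      sumPoints d (λ x → μ zero i * (productMass (μ ∘ suc) x * G (i ∷ x)))
        ≈⟨ sumPoints-cong d (λ x → *-assoc _ _ _) ⟨
      sumPoints d (λ x → productMass μ (i ∷ x) * G (i ∷ x)) ∎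

  -- This is `sumPoints-Φ` for the indicator of the event, with `c` the uniform mass of a point.
  Pr-Φ : ∀ {n N d} .{{_ : NonZero N}} {μ : Fin d → Fin n → ℝ}
         (q : Fin d → Fin n → ℕ) (Σq≡N : ∀ r → sumℕ (q r) ≡ N) →
         (∀ r j → μ r j ≈ fromℕ (q r j) / fromℕ N) →
         {A : Pred (Point n d) 0ℓ} (A? : Decidable A) →
         Pr uniform (A? ∘ Φ q Σq≡N) ≈ Pr (productMass μ) A?
  Pr-Φ {n} {N} {d} {μ} q Σq≡N μ≈q/N A? = begin-equality
    sumPoints d (λ x → if does (A? (Φ q Σq≡N x)) then uniform x else 0#)
      ≈⟨ sumPoints-cong d (λ x → if-*-indicator (does (A? (Φ q Σq≡N x))) (uniform x)) ⟩
    sumPoints d (λ x → c * G (Φ q Σq≡N x))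
      ≈⟨ sumPoints-Φ d q Σq≡N μN≈q G Nᵈc≈1 ⟩
    sumPoints d (λ x → productMass μ x * G x)
      ≈⟨ sumPoints-cong d (λ x → if-*-indicator (does (A? x)) (productMass μ x)) ⟨
    sumPoints d (λ x → if does (A? x) then productMass μ x else 0#) ∎
    where
    c : ℝ
    c = 1# / fromℕ (N ℕ.^ d)

    G : Point n d → ℝ
    G x = if does (A? x) then 1# else 0#

    Nᵈc≈1 : fromℕ (N ℕ.^ d) * c ≈ 1#
    Nᵈc≈1 = begin-equality
      fromℕ (N ℕ.^ d) * c                          ≈⟨ *-congˡ (*-identityˡ _) ⟩
      fromℕ (N ℕ.^ d) * fromℕ (N ℕ.^ d) ⁻¹         ≈⟨ *-inverseʳ (fromℕ≉0 (N ℕ.^ d) {{ℕₚ.m^n≢0 N d}}) ⟩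
      1#                                           ∎

    μN≈q : ∀ r j → μ r j * fromℕ N ≈ fromℕ (q r j)
    μN≈q r j = begin-equality
      μ r j * fromℕ N                          ≈⟨ *-congʳ (μ≈q/N r j) ⟩
      fromℕ (q r j) * fromℕ N ⁻¹ * fromℕ N     ≈⟨ *-assoc _ _ _ ⟩
      fromℕ (q r j) * (fromℕ N ⁻¹ * fromℕ N)   ≈⟨ *-congˡ (*-comm _ _) ⟩
      fromℕ (q r j) * (fromℕ N * fromℕ N ⁻¹)   ≈⟨ *-congˡ (*-inverseʳ (fromℕ≉0 N)) ⟩
      fromℕ (q r j) * 1#                       ≈⟨ *-identityʳ _ ⟩
      fromℕ (q r j)                            ∎

  -- The function of a bounding family as a sum of steps, and its triangle inequality.

  -- With b = [t < x_r] and b′ = [t < y_r], the contribution of t to the r-th summand of d_𝓑(x, y).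
  step : ℝ → ℝ → Bool → Bool → ℝ
  step l u true  false = u
  step l u false true  = - l
  step l u _     _     = 0#

  step-self : ∀ l u b → step l u b b ≈ 0#
  step-self l u true  = refl
  step-self l u false = refl

  -- On two states, passing from `true` to `false` costs `u` and passing back costs `- l`. A detour
  -- is free unless it leaves a state and returns to it, in which case it costs `u - l`, which is
  -- nonnegative.
  step-triangle : ∀ {l u} → l ≤ u → ∀ a b c → step l u a c ≤ step l u a b + step l u b c
  step-triangle {l} {u} l≤u = go
    where
    0≤u-l : 0# ≤ u - l
    0≤u-l = Order.trans (Order.reflexive (sym (-‿inverseʳ l))) (+-monoˡ-≤ (- l) l≤u)

    go : ∀ a b c → step l u a c ≤ step l u a b + step l u b c
    go true  true  c     = Order.reflexive (sym (+-identityˡ _))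
    go false false c     = Order.reflexive (sym (+-identityˡ _))
    go true  false false = Order.reflexive (sym (+-identityʳ _))
    go false true  true  = Order.reflexive (sym (+-identityʳ _))
    go true  false true  = 0≤u-l
    go false true  false = Order.trans 0≤u-l (Order.reflexive (+-comm _ _))

  step-difference : ∀ l u b b′ →
    (if not b′ ∧ b then u else 0#) - (if not b ∧ b′ then l else 0#) ≈ step l u b b′
  step-difference l u true  true  = -‿inverseʳ 0#
  step-difference l u true  false = trans (+-congˡ -0#≈0#) (+-identityʳ u)
  step-difference l u false true  = +-identityˡ (- l)
  step-difference l u false false = -‿inverseʳ 0#

  -- Removes the outer comparisons in `dist-𝓑`: where such a comparison fails, the sum it guards is
  -- over an empty range.
  redundant-guard : ∀ {A : Set} (a? : Dec A) {s} → (¬ A → s ≈ 0#) → (if does a? then s else 0#) ≈ s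
  redundant-guard (yes a) ¬a⇒s≈0 = refl
  redundant-guard (no ¬a) ¬a⇒s≈0 = sym (¬a⇒s≈0 ¬a)

  sumBetween-empty : ∀ {m a b} (h : Fin m → ℝ) → ¬ a ℕ.< b → sumBetween a b h ≈ 0#
  sumBetween-empty {a = a} {b} h a≮b = sum-zero λ t → reflexive
    (≡.cong (if_then h t else 0#)
      (dec-false ((a ℕ.≤? toℕ t) ×-dec (toℕ t ℕ.<? b)) λ (a≤t , t<b) → a≮b (ℕₚ.≤-<-trans a≤t t<b)))

  module _ {n d} (𝓑 : BoundingFamily n d) where
    open BoundingFamily 𝓑

    private
      below : Fin d → Fin (n ℕ.∸ 1) → Point n d → Bool
      below r t x = does (toℕ t ℕ.<? toℕ (lookup x r))

      steps : Point n d → Point n d → ℝ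
      steps x y = sum λ r → sum λ t → step (l r t) (u r t) (below r t x) (below r t y)

    -- Once the outer guards are gone, the upper and lower sums merge term by term. Since `y_r ≤ t`
    -- is the negation of `t < y_r`, each term depends only on the bits `below r t x` and
    -- `below r t y`, and it is a `step`.
    dist-𝓑-steps : ∀ x y → dist-𝓑 𝓑 x y ≈ steps x y
    dist-𝓑-steps x y = begin-equality
      dist-𝓑 𝓑 x y
        ≈⟨ sum-distrib-- {d} _ _ ⟨
      sum (λ r → (if does (y′ r ℕ.<? x′ r) then sumBetween (y′ r) (x′ r) (u r) else 0#)
               - (if does (x′ r ℕ.<? y′ r) then sumBetween (x′ r) (y′ r) (l r) else 0#))
        ≈⟨ sum-cong-≋ (λ r → +-cong
             (redundant-guard (y′ r ℕ.<? x′ r) (sumBetween-empty (u r)))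
             (-‿cong (redundant-guard (x′ r ℕ.<? y′ r) (sumBetween-empty (l r))))) ⟩
      sum (λ r → sumBetween (y′ r) (x′ r) (u r) - sumBetween (x′ r) (y′ r) (l r))
        ≈⟨ sum-cong-≋ {d} (λ r → sum-distrib-- {n ℕ.∸ 1} _ _) ⟨
      sum (λ r → sum λ t →
          (if does (y′ r ℕ.≤? toℕ t) ∧ below r t x then u r t else 0#)
        - (if does (x′ r ℕ.≤? toℕ t) ∧ below r t y then l r t else 0#))
        ≈⟨ sum-cong-≋ (λ r → sum-cong-≋ λ t → reflexive (≡.cong₂
             (λ b b′ → (if b ∧ below r t x then u r t else 0#) - (if b′ ∧ below r t y then l r t else 0#))
             (does-≤?-not (y′ r) (toℕ t)) (does-≤?-not (x′ r) (toℕ t)))) ⟩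
      sum (λ r → sum λ t →
          (if not (below r t y) ∧ below r t x then u r t else 0#)
        - (if not (below r t x) ∧ below r t y then l r t else 0#))
        ≈⟨ sum-cong-≋ (λ r → sum-cong-≋ λ t → step-difference (l r t) (u r t) (below r t x) (below r t y)) ⟩
      steps x y ∎
      where
      x′ = λ r → toℕ (lookup x r)
      y′ = λ r → toℕ (lookup y r)

    dist-𝓑-self : ∀ x → dist-𝓑 𝓑 x x ≈ 0#
    dist-𝓑-self x = trans (dist-𝓑-steps x x)
      (sum-zero λ r → sum-zero λ t → step-self (l r t) (u r t) (below r t x))

    -- In the form `steps`, each pair of a coordinate `r` and a threshold `t` contributes
    -- independently, so the inequality holds term by term.
    dist-𝓑-triangle : ∀ x y z → dist-𝓑 𝓑 x z ≤ dist-𝓑 𝓑 x y + dist-𝓑 𝓑 y z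
    dist-𝓑-triangle x y z = begin
      dist-𝓑 𝓑 x z ≈⟨ dist-𝓑-steps x z ⟩
      steps x z
        ≤⟨ sum-mono-≤ (λ r → sum-mono-≤ λ t →
             step-triangle (proj₁ (l<u r t)) (below r t x) (below r t y) (below r t z)) ⟩
      sum (λ r → sum λ t → step (l r t) (u r t) (below r t x) (below r t y)
                         + step (l r t) (u r t) (below r t y) (below r t z))
        ≈⟨ sum-cong-≋ {d} (λ r → ∑-distrib-+ {n ℕ.∸ 1} _ _) ⟩
      sum (λ r → sum (λ t → step (l r t) (u r t) (below r t x) (below r t y))
               + sum (λ t → step (l r t) (u r t) (below r t y) (below r t z)))
        ≈⟨ ∑-distrib-+ {d} _ _ ⟩
      steps x y + steps y z ≈⟨ +-cong (dist-𝓑-steps x y) (dist-𝓑-steps y z) ⟨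
      dist-𝓑 𝓑 x y + dist-𝓑 𝓑 y z ∎

  -- Attained minima on finite grids.

  HasMinimum : {Y : Set} → (Y → ℝ) → Set
  HasMinimum F = ∃[ y ] ∀ z → F y ≤ F z

  minimum-Fin : ∀ {n} (F : Fin (suc n) → ℝ) → HasMinimum F
  minimum-Fin {n} F = argmin F zero (allFin (suc n)) ,
    λ i → All.lookup (f[argmin]≤f[xs] zero (allFin (suc n))) (∈-allFin i)

  -- Minimise over the tail for each first coordinate, then over the first coordinate. The side
  -- length `suc n` keeps the grid inhabited.
  minimum-Point : ∀ {n} d (F : Point (suc n) d → ℝ) → HasMinimum F
  minimum-Point zero    F = [] , λ { [] → Order.refl }
  minimum-Point (suc d) F = i ∷ proj₁ (tails i) ,
    λ { (j ∷ z) → Order.trans (i-min j) (proj₂ (tails j) z) }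
    where
    tails : ∀ i → HasMinimum (F ∘ (i ∷_))
    tails i = minimum-Point d (F ∘ (i ∷_))

    heads : HasMinimum (λ i → F (i ∷ proj₁ (tails i)))
    heads = minimum-Fin _

    i     = proj₁ heads
    i-min = proj₂ heads

  -- McShane extension for functions with the triangle inequality.

  module _ {X : Set} {δ : X → X → ℝ} (δ-triangle : ∀ x y z → δ x z ≤ δ x y + δ y z) where

    -- A rearranged triangle inequality. It shows that `𝓟 δ` is inhabited as soon as `X` is, which
    -- the existence of the distance relies on.
    basepoint-∈-𝓟 : ∀ p → (λ x → δ x p) ∈ 𝓟 δ
    basepoint-∈-𝓟 p x y = x≤y+z⇒x-z≤y (δ-triangle x y p)

    -- The minimum is attained, so `g` is written through a chosen minimiser `m x`. The two bounds
    -- on `g (ψ y)` have different sources: the competitor `y` itself, with `δ-self`, gives the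
    -- upper one, and membership of `h` in its class bounds every candidate below by `h y`.
    mcshane : (∀ x → δ x x ≈ 0#) →
              ∀ {Y : Set} → (∀ (F : Y → ℝ) → HasMinimum F) →
              ∀ (ψ : Y → X) {h} → h ∈ 𝓟 (δ on ψ) →
              ∃[ g ] g ∈ 𝓟 δ × (∀ y → g (ψ y) ≈ h y)
    mcshane δ-self {Y} minimum ψ {h} h∈𝓟 = g , g∈𝓟 , λ y → Order.antisym (g≤h y) (h≤g y)
      where
      m : X → Y
      m x = proj₁ (minimum λ y → h y + δ x (ψ y))

      g : X → ℝ
      g x = h (m x) + δ x (ψ (m x))

      g-min : ∀ x y → g x ≤ h y + δ x (ψ y)
      g-min x = proj₂ (minimum λ y → h y + δ x (ψ y))

      g∈𝓟 : g ∈ 𝓟 δ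
      g∈𝓟 x x′ = x≤y+z⇒x-z≤y (begin
        -- The minimiser for `x′` serves as a competitor in the minimum at `x`.
        g x                                       ≤⟨ g-min x (m x′) ⟩
        h (m x′) + δ x (ψ (m x′))                 ≤⟨ +-monoʳ-≤ _ (δ-triangle x x′ (ψ (m x′))) ⟩
        h (m x′) + (δ x x′ + δ x′ (ψ (m x′)))     ≈⟨ +-leftSwap _ _ _ ⟩
        δ x x′ + g x′                             ∎)

      g≤h : ∀ y → g (ψ y) ≤ h y
      g≤h y = begin
        g (ψ y)             ≤⟨ g-min (ψ y) y ⟩
        h y + δ (ψ y) (ψ y) ≈⟨ +-congˡ (δ-self (ψ y)) ⟩
        h y + 0#            ≈⟨ +-identityʳ (h y) ⟩
        h y                 ∎

      h≤g : ∀ y → h y ≤ g (ψ y)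
      h≤g y = begin
        h y                                       ≤⟨ x-z≤y⇒x≤y+z (h∈𝓟 y (m (ψ y))) ⟩
        δ (ψ y) (ψ (m (ψ y))) + h (m (ψ y))       ≈⟨ +-comm _ _ ⟩
        g (ψ y)                                   ∎

  -- Existence of infima and equality of the two distances.

  -- Completeness speaks of suprema, so the infimum is obtained as the supremum of the set of lower
  -- bounds. That set is bounded above by any element of `S`.
  infimum-exists : ∀ (S : Pred ℝ 0ℓ) → ∃ S → ∃ (LowerBound S) → ∃ (IsInfimum S)
  infimum-exists S (s , s∈S) lower
    with complete (LowerBound S) lower (s , λ b b≤S → b≤S s s∈S)
  ... | v , v-upper , v-least =
    v , (λ x x∈S → v-least x λ b b≤S → b≤S x x∈S) , v-upper

  IsInfimum-cong : ∀ {S T : Pred ℝ 0ℓ} {v} → S ⊆ T → T ⊆ S → IsInfimum S v → IsInfimum T v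
  IsInfimum-cong S⊆T T⊆S (v-lower , v-greatest) =
    (λ x x∈T → v-lower x (T⊆S x∈T)) , λ b b≤T → v-greatest b λ x x∈S → b≤T x (S⊆T x∈S)

  -- As `IsDist` is a relation, equality of the distances is expressed by a common value `v`. It is
  -- the infimum of `S`, and it carries over to `T` because `S` and `T` have the same elements.
  dist-Φ : ∀ {n d} (𝓑 : BoundingFamily n d) N .{{_ : NonZero N}} {μ : Fin d → Fin n → ℝ} → (∀ r j → 0# ≤ μ r j) →
           (q : Fin d → Fin n → ℕ) (Σq≡N : ∀ r → sumℕ (q r) ≡ N) →
           (∀ r j → μ r j ≈ fromℕ (q r j) / fromℕ N) →
           ∀ (f : Point n d → ℝ) →
           ∃[ v ] IsDist (productMass μ) f (𝓟 (dist-𝓑 𝓑)) v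
                × IsDist uniform (f ∘ Φ q Σq≡N) (𝓟 (dist-𝓑 𝓑 on Φ q Σq≡N)) v
  -- Matching `N` as a successor makes `[N]^d` visibly inhabited, as `minimum-Point` and the base
  -- point below require.
  dist-Φ {n} {d} 𝓑 N@(suc _) {μ} 0≤μ q Σq≡N μ≈q/N f =
    proj₁ infimum , proj₂ infimum , IsInfimum-cong S⊆T T⊆S (proj₂ infimum)
    where
    Φ′ : Point N d → Point n d
    Φ′ = Φ q Σq≡N

    S T : Pred ℝ 0ℓ
    S p = ∃[ g ] g ∈ 𝓟 (dist-𝓑 𝓑) × p ≈ Pr (productMass μ) (λ x → ¬? (f x ≟ g x))
    T p = ∃[ h ] h ∈ 𝓟 (dist-𝓑 𝓑 on Φ′) × p ≈ Pr uniform (λ x → ¬? (f (Φ′ x) ≟ h x))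

    Pr-Φ′ : ∀ g → Pr uniform (λ x → ¬? (f (Φ′ x) ≟ g (Φ′ x))) ≈ Pr (productMass μ) (λ x → ¬? (f x ≟ g x))
    Pr-Φ′ g = Pr-Φ q Σq≡N μ≈q/N (λ x → ¬? (f x ≟ g x))

    S⊆T : S ⊆ T
    S⊆T (g , g∈𝓟 , p≈) = g ∘ Φ′ , (λ x y → g∈𝓟 (Φ′ x) (Φ′ y)) , trans p≈ (sym (Pr-Φ′ g))

    T⊆S : T ⊆ S
    T⊆S (h , h∈𝓟 , p≈) with mcshane (dist-𝓑-triangle 𝓑) (dist-𝓑-self 𝓑) (minimum-Point d) Φ′ h∈𝓟
    ... | g , g∈𝓟 , gΦ≈h = g , g∈𝓟 , trans p≈ (trans
      -- Since `g ∘ Φ′` agrees with `h` everywhere, `f ∘ Φ′` differs from both at the same points.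
      (Pr-cong uniform (λ x → ¬? (f (Φ′ x) ≟ h x)) (λ x → ¬? (f (Φ′ x) ≟ g (Φ′ x)))
        (λ {x} f≉h f≈g → f≉h (trans f≈g (gΦ≈h x)))
        (λ {x} f≉g f≈h → f≉g (trans f≈h (sym (gΦ≈h x)))))
      (Pr-Φ′ g))

    infimum : ∃ (IsInfimum S)
    infimum = infimum-exists S
      -- A point of `[n]^d` is obtained as the image of one of `[N]^d`, as `n` itself is not given
      -- as a successor.
      (_ , _ , basepoint-∈-𝓟 (dist-𝓑-triangle 𝓑) (Φ′ (replicate d zero)) , refl)
      -- Probabilities are nonnegative because the product masses are, so 0 is a lower bound.
      (0# , λ p (g , _ , p≈) → Order.trans
        (Pr-nonneg (λ x → ¬? (f x ≟ g x)) (λ x → product-nonneg λ r → 0≤μ r (lookup x r)))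
        (Order.reflexive (sym p≈)))

theorem3p8 :
    (R : Reals) → let open RealFunctions R in
    ∀ (n d : ℕ) (𝓑 : BoundingFamily n d) (N : ℕ) .{{_ : NonZero N}}
      (μ : Fin d → Fin n → ℝ) (μ-dist : ∀ r → IsDistribution (μ r))
      (q : Fin d → Fin n → ℕ) (μ≈q/N : ∀ r j → μ r j ≈ fromℕ (q r j) / fromℕ N) →
    let Φ′   = Φ q (λ r → sum-weights N (μ-dist r) (μ≈q/N r))
        dext = dist-𝓑 𝓑 on Φ′ in
    ∀ (f : Point n d → ℝ) →
    ∃[ v ] IsDist (productMass μ) f (𝓟 (dist-𝓑 𝓑)) v
         × IsDist uniform (f ∘ Φ′) (𝓟 dext) v
theorem3p8 R n d 𝓑 N μ μ-dist q μ≈q/N =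
  dist-Φ 𝓑 N (λ r → proj₁ (μ-dist r)) q (λ r → sum-weights N (μ-dist r) (μ≈q/N r)) μ≈q/N
  where
  open RealFunctions R
  open RealLemmas R
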